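{- Let $G$ be a (finite, simple, non-null) graph without isolated vertices such that $\Delta(G)-\delta(G)\leq 3$. If $\frac{M_1(G)}{n(G)}>\frac{M_2(G)}{m(G)}$, then $\delta(G)=2$, $\Delta(G)=5$, $m_{2,5}(G)\neq 0$, and $m_{3,3}(G)\neq 0$.
   Context: All graphs are finite, simple, non-null and have no isolated vertices (they need not be connected). For a graph $G$ with vertex set $V(G)$ and edge set $E(G)$: $n(G)=|V(G)|$ is the order, $m(G)=|E(G)|$ is the size, $d_G(u)$ is the degree of a vertex $u$, and $\Delta(G)$ and $\delta(G)$ are the maximum and minimum degrees. The first and second Zagreb indices are $M_1(G)=\sum_{v\in V(G)}d_G(v)^2$ and $M_2(G)=\sum_{uv\in E(G)}d_G(u)d_G(v)$. For positive integers $i,j$, $m_{i,j}(G)$ is the number of edges of $G$ joining a vertex of degree $i$ to a vertex of degree $j$. -}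

module Defs where

open import Data.Nat using (ℕ; suc; _*_; _^_; NonZero; >-nonZero; _≟_)
open import Data.Fin using (Fin; zero; _<_; _<?_)
open import Data.Fin.Properties using (<-cmp)
open import Data.List using (List; length; map; filter; allFin; cartesianProduct)
open import Data.List.Extrema.Nat using (max; min)
open import Data.List.Membership.Propositional using (_∈_)
open import Data.List.Membership.Propositional.Properties
  using (∈-filter⁺; ∈-cartesianProduct⁺; ∈-allFin; ∈-length)
open import Data.Nat.ListAction using (sum)
open import Data.Product using (_×_; _,_; ∃-syntax)
open import Data.Sum using (_⊎_)
open import Level using (0ℓ)
open import Relation.Binary using (Rel; Symmetric; Decidable; tri<; tri≈; tri>)
open import Relation.Binary.PropositionalEquality using (_≡_; refl)
open import Relation.Nullary using (¬_; contradiction)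
open import Relation.Nullary.Decidable using (_×-dec_; _⊎-dec_)

record Graph (n : ℕ) : Set₁ where
  field
    Adj    : Rel (Fin n) 0ℓ
    adj?   : Decidable Adj
    symm   : Symmetric Adj
    irrefl : ∀ u → ¬ Adj u u

open Graph public

NoIsolatedVertices : ∀ {n} → Graph n → Set
NoIsolatedVertices G = ∀ u → ∃[ v ] Adj G u v

order : ∀ {n} → Graph n → ℕ
order {n} _ = n

-- Each unordered edge uv occurs exactly once, as the pair with u < v.
edges : ∀ {n} → Graph n → List (Fin n × Fin n)
edges {n} G = filter (λ (u , v) → (u <? v) ×-dec adj? G u v)
                     (cartesianProduct (allFin n) (allFin n))

size : ∀ {n} → Graph n → ℕ
size G = length (edges G)

degree : ∀ {n} → Graph n → Fin n → ℕ
degree {n} G u = length (filter (adj? G u) (allFin n))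

Δ : ∀ {n} → Graph n → ℕ
Δ {n} G = max 0 (map (degree G) (allFin n))

-- The first argument of min is only a default: every degree is at most n, so
-- for n ≥ 1 this is the true minimum of the degrees.
δ : ∀ {n} → Graph n → ℕ
δ {n} G = min n (map (degree G) (allFin n))

M₁ : ∀ {n} → Graph n → ℕ
M₁ {n} G = sum (map (λ v → degree G v ^ 2) (allFin n))

M₂ : ∀ {n} → Graph n → ℕ
M₂ G = sum (map (λ (u , v) → degree G u * degree G v) (edges G))

-- Edges are listed with one fixed orientation, so both assignments of the
-- degrees i and j to the endpoints have to be allowed.
edgesWithDegrees : ∀ {n} → Graph n → ℕ → ℕ → ℕ
edgesWithDegrees G i j =
  length (filter (λ (u , v) →
            ((degree G u ≟ i) ×-dec (degree G v ≟ j))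
            ⊎-dec ((degree G u ≟ j) ×-dec (degree G v ≟ i)))
          (edges G))

private
  edge∈edges : ∀ {n} (G : Graph n) {u v} → u < v → Adj G u v → (u , v) ∈ edges G
  edge∈edges {n} G {u} {v} u<v uv =
    ∈-filter⁺ (λ (u , v) → (u <? v) ×-dec adj? G u v)
              (∈-cartesianProduct⁺ (∈-allFin u) (∈-allFin v)) (u<v , uv)

size-nonZero : ∀ {n} .{{_ : NonZero n}} (G : Graph n) →
               NoIsolatedVertices G → NonZero (size G)
size-nonZero {suc _} G noIso with noIso zero
... | v , 0v with <-cmp zero v
... | tri< 0<v _ _  = >-nonZero (∈-length (edge∈edges G 0<v 0v))
... | tri≈ _ refl _ = contradiction 0v (irrefl G zero)
... | tri> _ _ ()

{-# OPTIONS --safe #-}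

-- With L a common multiple of all degrees and w(v) = L / d(v), double counting gives
--   M₁ = Σ_{uv ∈ E} (d(u) + d(v))   and   L n = Σ_{uv ∈ E} (w(u) + w(v)),
-- and L (d(u) + d(v)) = d(u)d(v) (w(u) + w(v)).  So if f = d(u)d(v) and
-- g = w(u) + w(v) were oppositely ordered on the edges, Chebyshev's sum
-- inequality would give m M₁ ≤ n M₂.  Hence M₁/n > M₂/m yields edges with end
-- degrees a, b and c, d such that ab > cd and 1/a + 1/b > 1/c + 1/d.
-- For s = a + b and t = c + d this forces t < s, and 4cd ≤ t² gives 4ab < st,
-- so s < (b − a)² ≤ 9 when a ≤ b ≤ a + 3.  What remains is finite, and only {2,5}, {3,3} survives.
module Submission where

open import Defs
open import Data.Bool using (if_then_else_; true; false)
open import Data.Fin as Fin using (Fin; _<?_)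
open import Data.Fin.Properties using (<-cmp)
open import Data.Integer as ℤ using (+_)
import Data.Integer.Properties as ℤ
open import Data.List using (List; []; _∷_; _++_; length; map; filter; allFin; cartesianProduct)
open import Data.List.Extrema.Nat using (min≤xs; xs≤max)
open import Data.List.Membership.Propositional using (_∈_; find; lose)
open import Data.List.Membership.Propositional.Properties
  using (∈-filter⁺; ∈-allFin; ∈-length; ∈-map⁺)
open import Data.List.Properties using (map-cong; map-++; map-∘; length-tabulate)
open import Data.List.Relation.Unary.All using (lookup; tabulate)
open import Data.List.Relation.Unary.All.Properties using (map⁺)
open import Data.List.Relation.Unary.Any using (here; there; any?)
open import Data.Nat
  using (ℕ; suc; NonZero; >-nonZero; z≤n; s≤s; s≤s⁻¹; _+_; _*_; _∸_; _≤_; _<_; _≤?_; _≟_)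
  renaming (_<?_ to _<ⁿ?_)
open import Data.Nat.Divisibility using (_∣_; module _∣_)
open import Data.Nat.ListAction using (sum; product)
open import Data.Nat.ListAction.Properties using (sum-++; ∈⇒∣product; product≢0)
open import Data.Nat.Properties hiding (_≤?_; _≟_; _<?_; <-cmp)
open import Data.Nat.Tactic.RingSolver using (solve-∀)
open import Data.Product using (_×_; _,_; ∃-syntax)
open import Data.Rational using (_/_; _>_)
open import Data.Rational.Properties using (toℚᵘ-mono-<; toℚᵘ-fromℚᵘ)
open import Data.Rational.Unnormalised using (mkℚᵘ)
import Data.Rational.Unnormalised.Properties as ℚᵘ
open import Data.Sum using (_⊎_; inj₁; inj₂)
open import Function using (id; _∘_)
open import Relation.Binary using (tri<; tri≈; tri>)
open import Relation.Binary.PropositionalEquality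
  using (_≡_; _≢_; refl; sym; trans; cong; cong₂; subst; subst₂; module ≡-Reasoning)
open import Relation.Nullary using (¬_; Dec; yes; no; does; contradiction)
open import Relation.Nullary.Decidable using (_×-dec_; _→-dec_; map′; from-yes)
open import Relation.Unary using (Decidable)

private variable
  A B : Set

-- Finite sums over lists, and indicators.

+-interchange : ∀ a b c d → a + b + (c + d) ≡ a + c + (b + d)
+-interchange = solve-∀

∑ : List A → (A → ℕ) → ℕ
∑ xs f = sum (map f xs)

∑-cong : ∀ (xs : List A) {f g} → (∀ x → f x ≡ g x) → ∑ xs f ≡ ∑ xs g
∑-cong xs f≗g = cong sum (map-cong f≗g xs)

∑-distrib-+ : ∀ (xs : List A) f g → ∑ xs (λ x → f x + g x) ≡ ∑ xs f + ∑ xs g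
∑-distrib-+ []       f g = refl
∑-distrib-+ (x ∷ xs) f g = trans (cong (λ s → f x + g x + s) (∑-distrib-+ xs f g))
  (+-interchange (f x) (g x) (∑ xs f) (∑ xs g))

*-distribˡ-∑ : ∀ (xs : List A) c f → c * ∑ xs f ≡ ∑ xs (λ x → c * f x)
*-distribˡ-∑ []       c f = *-zeroʳ c
*-distribˡ-∑ (x ∷ xs) c f =
  trans (*-distribˡ-+ c (f x) (∑ xs f)) (cong (λ s → c * f x + s) (*-distribˡ-∑ xs c f))

∑-const : ∀ (xs : List A) c → ∑ xs (λ _ → c) ≡ length xs * c
∑-const []       c = refl
∑-const (x ∷ xs) c = cong (_+_ c) (∑-const xs c)

∑-comm : ∀ (xs : List A) (ys : List B) (f : A → B → ℕ) →
         ∑ xs (λ x → ∑ ys (f x)) ≡ ∑ ys (λ y → ∑ xs (λ x → f x y))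
∑-comm []       ys f = sym (trans (∑-const ys 0) (*-zeroʳ (length ys)))
∑-comm (x ∷ xs) ys f =
  trans (cong (λ s → ∑ ys (f x) + s) (∑-comm xs ys f)) (sym (∑-distrib-+ ys (f x) _))

∑-cartesianProduct : ∀ (xs : List A) (ys : List B) (f : A × B → ℕ) →
  ∑ (cartesianProduct xs ys) f ≡ ∑ xs (λ x → ∑ ys (λ y → f (x , y)))
∑-cartesianProduct []       ys f = refl
∑-cartesianProduct (x ∷ xs) ys f = begin
  sum (map f (map (x ,_) ys ++ cartesianProduct xs ys))
    ≡⟨ cong sum (map-++ f (map (x ,_) ys) _) ⟩
  sum (map f (map (x ,_) ys) ++ map f (cartesianProduct xs ys))
    ≡⟨ sum-++ (map f (map (x ,_) ys)) _ ⟩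
  sum (map f (map (x ,_) ys)) + ∑ (cartesianProduct xs ys) f
    ≡⟨ cong₂ _+_ (cong sum (sym (map-∘ ys))) (∑-cartesianProduct xs ys f) ⟩
  ∑ ys (λ y → f (x , y)) + ∑ xs (λ x → ∑ ys (λ y → f (x , y))) ∎
  where open ≡-Reasoning

𝟙 : {P : Set} → Dec P → ℕ
𝟙 P? = if does P? then 1 else 0

-- A filter becomes a 0/1 factor, so a sum over edges can be treated as an unrestricted double sum
-- over vertices.
∑-filter : {P : A → Set} (P? : Decidable P) (xs : List A) (f : A → ℕ) →
           ∑ (filter P? xs) f ≡ ∑ xs (λ x → 𝟙 (P? x) * f x)
∑-filter P? []       f = refl
∑-filter P? (x ∷ xs) f with does (P? x)
... | true  = cong₂ _+_ (sym (+-identityʳ (f x))) (∑-filter P? xs f)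
... | false = ∑-filter P? xs f

length-filter≡∑𝟙 : {P : A → Set} (P? : Decidable P) (xs : List A) →
                   length (filter P? xs) ≡ ∑ xs (λ x → 𝟙 (P? x))
length-filter≡∑𝟙 P? xs = begin
  length (filter P? xs)      ≡⟨ *-identityʳ _ ⟨
  length (filter P? xs) * 1  ≡⟨ ∑-const (filter P? xs) 1 ⟨
  ∑ (filter P? xs) (λ _ → 1) ≡⟨ ∑-filter P? xs (λ _ → 1) ⟩
  ∑ xs (λ x → 𝟙 (P? x) * 1)  ≡⟨ ∑-cong xs (λ x → *-identityʳ (𝟙 (P? x))) ⟩
  ∑ xs (λ x → 𝟙 (P? x))      ∎
  where open ≡-Reasoning

-- Chebyshev's sum inequality and its contrapositive.

-- The two sides differ by (b - a)(d - c), which is `k * l` below.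
rearrangement : ∀ {a b c d} → a ≤ b → c ≤ d → a * d + b * c ≤ a * c + b * d
rearrangement {a} {_} {c} a≤b c≤d
  with k , refl ← m≤n⇒∃[o]m+o≡n a≤b
  with l , refl ← m≤n⇒∃[o]m+o≡n c≤d =
  subst (a * (c + l) + (a + k) * c ≤_) (expand a k c l) (m≤m+n _ (k * l))
  where
  expand : ∀ a k c l → a * (c + l) + (a + k) * c + k * l ≡ a * c + (a + k) * (c + l)
  expand = solve-∀

-- Strict in both functions, so that ties count as oppositely ordered, and directed, so that a pair
-- has to be excluded both ways round.
SimilarlyOrdered : (f g : A → ℕ) → A → A → Set
SimilarlyOrdered f g x y = f y < f x × g y < g x

rearrangement-pair : ∀ (f g : A → ℕ) x y →
  ¬ SimilarlyOrdered f g x y → ¬ SimilarlyOrdered f g y x →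
  f x * g x + f y * g y ≤ f x * g y + f y * g x
rearrangement-pair f g x y ¬xy ¬yx with ≤-total (f x) (f y) | ≤-total (g x) (g y)
... | inj₁ fx≤fy | inj₂ gy≤gx = rearrangement fx≤fy gy≤gx
... | inj₂ fy≤fx | inj₁ gx≤gy =
  subst₂ _≤_ (+-comm (f y * g y) _) (+-comm (f y * g x) _) (rearrangement fy≤fx gx≤gy)
-- When `f` and `g` move in the same direction, one of them must be tied, and a tie makes the two
-- sides equal.
... | inj₁ fx≤fy | inj₁ gx≤gy with m≤n⇒m<n∨m≡n fx≤fy | m≤n⇒m<n∨m≡n gx≤gy
...   | inj₁ fx<fy | inj₁ gx<gy = contradiction (fx<fy , gx<gy) ¬yx
...   | inj₂ fx≡fy | _          rewrite fx≡fy = ≤-reflexive (+-comm (f y * g x) _)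
...   | inj₁ _     | inj₂ gx≡gy rewrite gx≡gy = ≤-refl
rearrangement-pair f g x y ¬xy ¬yx
    | inj₂ fy≤fx | inj₂ gy≤gx with m≤n⇒m<n∨m≡n fy≤fx | m≤n⇒m<n∨m≡n gy≤gx
...   | inj₁ fy<fx | inj₁ gy<gx = contradiction (fy<fx , gy<gx) ¬xy
...   | inj₂ fy≡fx | _          rewrite fy≡fx = ≤-reflexive (+-comm (f x * g x) _)
...   | inj₁ _     | inj₂ gy≡gx rewrite gy≡gx = ≤-refl

-- The pair inequalities of `x` against each entry of `ys`, added up: these are the cross terms that
-- a new head contributes in `chebyshev`.
chebyshev-step : ∀ (f g : A → ℕ) x (ys : List A) →
  (∀ {y} → y ∈ ys → f x * g x + f y * g y ≤ f x * g y + f y * g x) →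
  length ys * (f x * g x) + ∑ ys (λ y → f y * g y) ≤ f x * ∑ ys g + ∑ ys f * g x
chebyshev-step f g x []       _    = z≤n
chebyshev-step f g x (y ∷ ys) pair = begin
  f x * g x + length ys * (f x * g x) + (f y * g y + ∑ ys (λ y → f y * g y))
    ≡⟨ +-interchange (f x * g x) _ (f y * g y) _ ⟩
  f x * g x + f y * g y + (length ys * (f x * g x) + ∑ ys (λ y → f y * g y))
    ≤⟨ +-mono-≤ (pair (here refl)) (chebyshev-step f g x ys (pair ∘ there)) ⟩
  f x * g y + f y * g x + (f x * ∑ ys g + ∑ ys f * g x)
    ≡⟨ collect (f x) (g x) (f y) (g y) (∑ ys f) (∑ ys g) ⟩
  f x * (g y + ∑ ys g) + (f y + ∑ ys f) * g x ∎
  where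
  open ≤-Reasoning
  collect : ∀ a b c d F G → a * d + c * b + (a * G + F * b) ≡ a * (d + G) + (c + F) * b
  collect = solve-∀

-- Induction on the list: both sides split into the diagonal term of the head, its cross terms with
-- the tail, and the inequality for the tail.
chebyshev : ∀ (f g : A → ℕ) (xs : List A) →
  (∀ {x y} → x ∈ xs → y ∈ xs → ¬ SimilarlyOrdered f g x y) →
  length xs * ∑ xs (λ x → f x * g x) ≤ ∑ xs f * ∑ xs g
chebyshev f g []       opp = ≤-refl
chebyshev f g (x ∷ xs) opp = begin
  (1 + length xs) * (f x * g x + S)
    ≡⟨ expand (length xs) (f x * g x) S ⟩
  f x * g x + (length xs * (f x * g x) + S) + length xs * S
    ≤⟨ +-mono-≤ (+-monoʳ-≤ (f x * g x) (chebyshev-step f g x xs λ {y} y∈xs →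
         rearrangement-pair f g x y (opp (here refl) (there y∈xs))
                                    (opp (there y∈xs) (here refl))))
         (chebyshev f g xs λ x∈xs y∈xs → opp (there x∈xs) (there y∈xs)) ⟩
  f x * g x + (f x * ∑ xs g + ∑ xs f * g x) + ∑ xs f * ∑ xs g
    ≡⟨ collect (f x) (g x) (∑ xs f) (∑ xs g) ⟩
  (f x + ∑ xs f) * (g x + ∑ xs g) ∎
  where
  open ≤-Reasoning
  S = ∑ xs (λ x → f x * g x)
  expand : ∀ k p S → (1 + k) * (p + S) ≡ p + (k * p + S) + k * S
  expand = solve-∀
  collect : ∀ a b F G → a * b + (a * G + F * b) + F * G ≡ (a + F) * (b + G)
  collect = solve-∀

∑∑<length*∑⇒∃similarlyOrdered : ∀ (f g : A → ℕ) (xs : List A) →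
  ∑ xs f * ∑ xs g < length xs * ∑ xs (λ x → f x * g x) →
  ∃[ x ] ∃[ y ] x ∈ xs × y ∈ xs × SimilarlyOrdered f g x y
∑∑<length*∑⇒∃similarlyOrdered f g xs ∑∑<
  -- Strict comparison is decidable, so the witness is found by search; a failed search supplies the
  -- hypothesis of `chebyshev`.
  with any? (λ x → any? (λ y → (f y <ⁿ? f x) ×-dec (g y <ⁿ? g x)) xs) xs
... | yes similar =
  let x , x∈xs , similar-x = find similar
      y , y∈xs , similar-xy = find similar-x
  in x , y , x∈xs , y∈xs , similar-xy
... | no ¬similar = contradiction
  (chebyshev f g xs λ x∈xs y∈xs similar-xy → ¬similar (lose x∈xs (lose y∈xs similar-xy)))
  (<⇒≱ ∑∑<)

-- Inverted quadruples and the finite search.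

-- ab > cd together with 1/a + 1/b > 1/c + 1/d, the latter with denominators cleared.
record Inverted (a b c d : ℕ) : Set where
  constructor inverted
  field
    product> : c * d < a * b
    reciprocalSum> : (c + d) * (a * b) < (a + b) * (c * d)

open Inverted

inverted? : ∀ a b c d → Dec (Inverted a b c d)
inverted? a b c d = map′ (λ (p , r) → inverted p r) (λ inv → product> inv , reciprocalSum> inv)
  ((c * d <ⁿ? a * b) ×-dec ((c + d) * (a * b) <ⁿ? (a + b) * (c * d)))

inverted-comm : ∀ {a b c d} → Inverted a b c d → Inverted b a c d
inverted-comm {a} {b} (inverted p r) rewrite *-comm a b | +-comm a b = inverted p r

-- The core is 2mn ≤ m² + n², which is `rearrangement` for the pair m, n taken twice; adding 2mn to
-- both sides avoids subtraction.
4*m*n≤[m+n]² : ∀ m n → 4 * (m * n) ≤ (m + n) * (m + n)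
4*m*n≤[m+n]² m n = subst₂ _≤_ (lhs m n) (rhs m n) (+-monoʳ-≤ (2 * (m * n)) 2mn≤m²+n²)
  where
  2mn≤m²+n² : m * n + n * m ≤ m * m + n * n
  2mn≤m²+n² with ≤-total m n
  ... | inj₁ m≤n = rearrangement m≤n m≤n
  ... | inj₂ n≤m = subst₂ _≤_ (+-comm (n * m) _) (+-comm (n * n) _) (rearrangement n≤m n≤m)
  lhs : ∀ m n → 2 * (m * n) + (m * n + n * m) ≡ 4 * (m * n)
  lhs = solve-∀
  rhs : ∀ m n → 2 * (m * n) + (m * m + n * n) ≡ (m + n) * (m + n)
  rhs = solve-∀

module _ {a b c d : ℕ} (inv : Inverted a b c d) where
  open ≤-Reasoning

  -- Otherwise a + b ≤ c + d and cd < ab multiply to contradict the reciprocal inequality.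
  inverted⇒sum< : c + d < a + b
  inverted⇒sum< = ≰⇒> λ s≤t → <-irrefl refl (begin-strict
    (c + d) * (a * b) <⟨ reciprocalSum> inv ⟩
    (a + b) * (c * d) ≤⟨ *-mono-≤ s≤t (<⇒≤ (product> inv)) ⟩
    (c + d) * (a * b) ∎)

  -- Replacing cd by its upper bound t²/4 in t·ab < s·cd leaves a common factor t to cancel.
  inverted⇒4ab<st : 4 * (a * b) < (a + b) * (c + d)
  inverted⇒4ab<st = *-cancelʳ-< (c + d) _ _ (begin-strict
    4 * (a * b) * (c + d)         ≡⟨ rotate 4 (a * b) (c + d) ⟩
    4 * ((c + d) * (a * b))       <⟨ *-monoʳ-< 4 (reciprocalSum> inv) ⟩
    4 * ((a + b) * (c * d))       ≡⟨ exchange 4 (a + b) (c * d) ⟩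
    (a + b) * (4 * (c * d))       ≤⟨ *-monoʳ-≤ (a + b) (4*m*n≤[m+n]² c d) ⟩
    (a + b) * ((c + d) * (c + d)) ≡⟨ *-assoc (a + b) (c + d) (c + d) ⟨
    (a + b) * (c + d) * (c + d)   ∎)
    where
    rotate : ∀ x y z → x * y * z ≡ x * (z * y)
    rotate = solve-∀
    exchange : ∀ x y z → x * (y * z) ≡ y * (x * z)
    exchange = solve-∀

inverted⇒sum<diff² : ∀ {a k c d} → Inverted a (a + k) c d → a + (a + k) < k * k
inverted⇒sum<diff² {a} {k} {c} {d} inv = +-cancelʳ-< (4 * (a * (a + k))) _ _ (begin-strict
  s + 4 * (a * (a + k))     <⟨ +-monoʳ-< s (inverted⇒4ab<st inv) ⟩
  s + s * (c + d)           ≡⟨ *-suc s (c + d) ⟨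
  -- Over the integers t < s means t + 1 ≤ s; this is where the extra summand s is absorbed.
  s * suc (c + d)           ≤⟨ *-monoʳ-≤ s (inverted⇒sum< inv) ⟩
  s * s                     ≡⟨ square a k ⟩
  k * k + 4 * (a * (a + k)) ∎)
  where
  open ≤-Reasoning
  s = a + (a + k)
  square : ∀ a k → (a + (a + k)) * (a + (a + k)) ≡ k * k + 4 * (a * (a + k))
  square = solve-∀

inverted⇒2,5,3,3 : ∀ {a b c d} → 0 < a → a ≤ b → b ≤ a + 3 → Inverted a b c d →
                   a ≡ 2 × b ≡ 5 × c ≡ 3 × d ≡ 3
inverted⇒2,5,3,3 {a} {_} {c} {d} 0<a a≤b b≤a+3 inv
  with k , refl ← m≤n⇒∃[o]m+o≡n a≤b
  = finite a<3 k<4 c<8 d<8 0<a inv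
  where
  k<4 : k < 4
  k<4 = +-cancelˡ-< a _ _ (≤-trans (s≤s b≤a+3) (≤-reflexive (sym (+-suc a 3))))
  -- A bound linear in k, sharp at k = 3: it lets k cancel from 2a + k < 6 + k, leaving a < 3.
  k²≤6+k : k * k ≤ 6 + k
  k²≤6+k = from-yes (allUpTo? (λ k → k * k ≤? 6 + k) 4) k<4
  s<6+k : a + (a + k) < 6 + k
  s<6+k = <-≤-trans (inverted⇒sum<diff² {a} inv) k²≤6+k
  a<3 : a < 3
  a<3 = *-cancelˡ-< 2 _ _ (+-cancelʳ-< k (2 * a) 6 (subst (_< 6 + k) (double a k) s<6+k))
    where
    double : ∀ a k → a + (a + k) ≡ 2 * a + k
    double = solve-∀
  -- From s < 6 + k ≤ 9 follows s ≤ 8, and t < s.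
  c+d<8 : c + d < 8
  c+d<8 = <-≤-trans (inverted⇒sum< inv) (s≤s⁻¹ (<-≤-trans s<6+k (+-monoʳ-≤ 6 (s≤s⁻¹ k<4))))
  c<8 = ≤-<-trans (m≤m+n c d) c+d<8
  d<8 = ≤-<-trans (m≤n+m d c) c+d<8
  -- The bounds leave 3·4·8·8 = 768 quadruples, settled by evaluating the decision procedure.
  finite : ∀ {a} → a < 3 → ∀ {k} → k < 4 → ∀ {c} → c < 8 → ∀ {d} → d < 8 →
           0 < a → Inverted a (a + k) c d → a ≡ 2 × a + k ≡ 5 × c ≡ 3 × d ≡ 3
  finite = from-yes (allUpTo? (λ a → allUpTo? (λ k → allUpTo? (λ c → allUpTo? (λ d →
    (0 <ⁿ? a) →-dec inverted? a (a + k) c d →-dec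
    ((a ≟ 2) ×-dec (a + k ≟ 5) ×-dec (c ≟ 3) ×-dec (d ≟ 3))) 8) 8) 4) 3)

-- Clearing denominators.

-- The weights p, q, r, s are the reciprocals of a, b, c, d scaled by L.
reciprocalSum< : ∀ {L} a b c d p q r s .{{_ : NonZero (a * b * (c * d))}} →
  L ≡ p * a → L ≡ q * b → L ≡ r * c → L ≡ s * d →
  r + s < p + q → (c + d) * (a * b) < (a + b) * (c * d)
reciprocalSum< {L} a b c d p q r s pa qb rc sd r+s<p+q =
  *-cancelˡ-< L _ _ (begin-strict
    L * ((c + d) * (a * b))             ≡⟨ split L c d (a * b) ⟩
    (L * d + L * c) * (a * b)           ≡⟨ cong₂ (λ x y → (x * d + y * c) * (a * b)) rc sd ⟩
    (r * c * d + s * d * c) * (a * b)   ≡⟨ factor r s c d (a * b) ⟩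
    (r + s) * (a * b * (c * d))         <⟨ *-monoˡ-< (a * b * (c * d)) r+s<p+q ⟩
    (p + q) * (a * b * (c * d))         ≡⟨ cong ((p + q) *_) (*-comm (a * b) (c * d)) ⟩
    (p + q) * (c * d * (a * b))         ≡⟨ factor p q a b (c * d) ⟨
    (p * a * b + q * b * a) * (c * d)   ≡⟨ cong₂ (λ x y → (x * b + y * a) * (c * d)) pa qb ⟨
    (L * b + L * a) * (c * d)           ≡⟨ split L a b (c * d) ⟨
    L * ((a + b) * (c * d))             ∎)
  where
  open ≤-Reasoning
  split : ∀ L x y z → L * ((x + y) * z) ≡ (L * y + L * x) * z
  split = solve-∀
  factor : ∀ p q x y z → (p * x * y + q * y * x) * z ≡ (p + q) * (z * (x * y))
  factor = solve-∀

-- Since `_/_` reduces fractions, the comparison is moved to unnormalised rationals, where it is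
-- cross-multiplication by definition.
/-<⇒*-< : ∀ p q m n .{{_ : NonZero m}} .{{_ : NonZero n}} →
          (+ q) / n > (+ p) / m → p * n < q * m
/-<⇒*-< p q (suc m) (suc n) p/m<q/n =
  ℤ.drop‿+<+ (subst₂ ℤ._<_ (sym (ℤ.pos-* p (suc n))) (sym (ℤ.pos-* q (suc m)))
    (ℚᵘ.drop-*<* (ℚᵘ.<-respˡ-≃ (toℚᵘ-fromℚᵘ (mkℚᵘ (+ p) m))
      (ℚᵘ.<-respʳ-≃ (toℚᵘ-fromℚᵘ (mkℚᵘ (+ q) n)) (toℚᵘ-mono-< p/m<q/n)))))

-- Double counting over the edges.

module _ {n} (G : Graph n) where

  private
    d = degree G

  -- By trichotomy an adjacent pair is listed in exactly one orientation; irreflexivity excludes u =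
  -- v.
  𝟙-adj-split : ∀ {u v} (u<v? : Dec (u Fin.< v)) (v<u? : Dec (v Fin.< u))
                (uv? : Dec (Adj G u v)) (vu? : Dec (Adj G v u)) →
    𝟙 (u<v? ×-dec uv?) + 𝟙 (v<u? ×-dec vu?) ≡ 𝟙 uv?
  𝟙-adj-split _         _         (yes uv) (no ¬vu) = contradiction (symm G uv) ¬vu
  𝟙-adj-split _         _         (no ¬uv) (yes vu) = contradiction (symm G vu) ¬uv
  𝟙-adj-split (yes u<v) (yes v<u) _        _        = contradiction v<u (<-asym u<v)
  𝟙-adj-split (yes _)   (no _)    (yes _)  (yes _)  = refl
  𝟙-adj-split (yes _)   (no _)    (no _)   (no _)   = refl
  𝟙-adj-split (no _)    (yes _)   (yes _)  (yes _)  = refl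
  𝟙-adj-split (no _)    (yes _)   (no _)   (no _)   = refl
  𝟙-adj-split (no _)    (no _)    (no _)   (no _)   = refl
  𝟙-adj-split {u} {v} (no u≮v) (no v≮u) (yes uv) (yes _) with <-cmp u v
  ... | tri< u<v _ _   = contradiction u<v u≮v
  ... | tri> _ _ v<u   = contradiction v<u v≮u
  ... | tri≈ _ refl _  = contradiction uv (irrefl G u)

  -- Each vertex contributes its value of `h` once per incident edge. Taking `h` to be the degree
  -- yields `M₁`; taking it to be the weight `w` yields n L.
  handshake : ∀ (h : Fin n → ℕ) →
    ∑ (edges G) (λ (u , v) → h u + h v) ≡ ∑ (allFin n) (λ v → h v * d v)
  handshake h = begin
    ∑ (edges G) (λ (u , v) → h u + h v)
      ≡⟨ ∑-filter (λ (u , v) → (u <? v) ×-dec adj? G u v) (cartesianProduct V V) _ ⟩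
    ∑ (cartesianProduct V V) (λ (u , v) → e u v * (h u + h v))
      ≡⟨ ∑-cartesianProduct V V _ ⟩
    ∑ V (λ u → ∑ V (λ v → e u v * (h u + h v)))
      ≡⟨ ∑-cong V (λ u → trans (∑-cong V λ v → *-distribˡ-+ (e u v) (h u) (h v))
                               (∑-distrib-+ V _ _)) ⟩
    ∑ V (λ u → ∑ V (λ v → e u v * h u) + ∑ V (λ v → e u v * h v))
      ≡⟨ ∑-distrib-+ V _ _ ⟩
    ∑ V (λ u → ∑ V (λ v → e u v * h u)) + ∑ V (λ u → ∑ V (λ v → e u v * h v))
      -- Exchanging the summations in the second half makes u the vertex that carries `h` in both
      -- halves.
      ≡⟨ cong (_+_ _) (∑-comm V V _) ⟩
    ∑ V (λ u → ∑ V (λ v → e u v * h u)) + ∑ V (λ u → ∑ V (λ v → e v u * h u))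
      ≡⟨ ∑-distrib-+ V _ _ ⟨
    ∑ V (λ u → ∑ V (λ v → e u v * h u) + ∑ V (λ v → e v u * h u))
      ≡⟨ ∑-cong V row ⟩
    ∑ V (λ u → h u * d u) ∎
    where
    open ≡-Reasoning
    V = allFin n
    e : Fin n → Fin n → ℕ
    e u v = 𝟙 ((u <? v) ×-dec adj? G u v)
    merge : ∀ x y z → x * z + y * z ≡ z * (x + y)
    merge = solve-∀
    row : ∀ u → ∑ V (λ v → e u v * h u) + ∑ V (λ v → e v u * h u) ≡ h u * d u
    row u = begin
      ∑ V (λ v → e u v * h u) + ∑ V (λ v → e v u * h u)
        ≡⟨ ∑-distrib-+ V _ _ ⟨
      ∑ V (λ v → e u v * h u + e v u * h u)
        ≡⟨ ∑-cong V (λ v → trans (merge (e u v) (e v u) (h u))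
                       (cong (h u *_)
                         (𝟙-adj-split (u <? v) (v <? u) (adj? G u v) (adj? G v u)))) ⟩
      ∑ V (λ v → h u * 𝟙 (adj? G u v))
        ≡⟨ *-distribˡ-∑ V (h u) _ ⟨
      h u * ∑ V (λ v → 𝟙 (adj? G u v))
        ≡⟨ cong (h u *_) (length-filter≡∑𝟙 (adj? G u) V) ⟨
      h u * d u ∎

  δ≤degree : ∀ u → δ G ≤ d u
  δ≤degree u = lookup (min≤xs n (map d (allFin n))) (∈-map⁺ d (∈-allFin u))

  degree≤Δ : ∀ u → d u ≤ Δ G
  degree≤Δ u = lookup (xs≤max 0 (map d (allFin n))) (∈-map⁺ d (∈-allFin u))

  edgesWithDegrees≢0 : ∀ {i j u v} → (u , v) ∈ edges G →
    (d u ≡ i × d v ≡ j) ⊎ (d u ≡ j × d v ≡ i) → edgesWithDegrees G i j ≢ 0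
  edgesWithDegrees≢0 uv∈E ij = >⇒≢ (∈-length (∈-filter⁺ _ uv∈E ij))

  -- From the inequality of ratios to an inverted pair of edges.

  module _ (noIso : NoIsolatedVertices G) where

    degree>0 : ∀ u → 0 < d u
    degree>0 u = let v , uv = noIso u in ∈-length (∈-filter⁺ (adj? G u) (∈-allFin v) uv)

    -- As `w u` is L / d(u), comparing sums of weights compares sums of reciprocal degrees; positive
    -- degrees allow the denominators to be cleared.
    similarlyOrdered⇒inverted : ∀ L (w : Fin n → ℕ) → (∀ u → L ≡ w u * d u) → ∀ u v x y →
      SimilarlyOrdered (λ (u , v) → d u * d v) (λ (u , v) → w u + w v) (u , v) (x , y) →
      Inverted (d u) (d v) (d x) (d y)
    similarlyOrdered⇒inverted L w L≡w*d u v x y (dd< , w<) = inverted dd<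
      (reciprocalSum< (d u) (d v) (d x) (d y) (w u) (w v) (w x) (w y)
        {{m*n≢0 (d u * d v) (d x * d y) {{d*d≢0 u v}} {{d*d≢0 x y}}}}
        (L≡w*d u) (L≡w*d v) (L≡w*d x) (L≡w*d y) w<)
      where
      d*d≢0 : ∀ u v → NonZero (d u * d v)
      d*d≢0 u v = m*n≢0 (d u) (d v) {{>-nonZero (degree>0 u)}} {{>-nonZero (degree>0 v)}}

    similarlyOrderedEdges : ∀ L .{{_ : NonZero L}} (w : Fin n → ℕ) → (∀ u → L ≡ w u * d u) →
      M₂ G * n < M₁ G * size G →
      ∃[ e ] ∃[ e′ ] e ∈ edges G × e′ ∈ edges G ×
        SimilarlyOrdered (λ (u , v) → d u * d v) (λ (u , v) → w u + w v) e e′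
    similarlyOrderedEdges L w L≡w*d M₂n<M₁m =
      ∑∑<length*∑⇒∃similarlyOrdered
        (λ (u , v) → d u * d v) (λ (u , v) → w u + w v) (edges G) ∑∑<
      where
      open ≤-Reasoning
      ∑w≡n*L : ∑ (edges G) (λ (u , v) → w u + w v) ≡ n * L
      ∑w≡n*L = begin-equality
        ∑ (edges G) (λ (u , v) → w u + w v) ≡⟨ handshake w ⟩
        ∑ (allFin n) (λ u → w u * d u)      ≡⟨ ∑-cong (allFin n) (λ u → sym (L≡w*d u)) ⟩
        ∑ (allFin n) (λ _ → L)              ≡⟨ ∑-const (allFin n) L ⟩
        length (allFin n) * L               ≡⟨ cong (_* L) (length-tabulate {n = n} id) ⟩
        n * L                               ∎
      L*d+d : ∀ u v → d u * d v * (w u + w v) ≡ L * (d u + d v)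
      L*d+d u v = begin-equality
        d u * d v * (w u + w v)                 ≡⟨ expand (d u) (d v) (w u) (w v) ⟩
        w v * d v * d u + w u * d u * d v
          ≡⟨ cong₂ (λ x y → x * d u + y * d v) (L≡w*d v) (L≡w*d u) ⟨
        L * d u + L * d v                       ≡⟨ *-distribˡ-+ L (d u) (d v) ⟨
        L * (d u + d v)                         ∎
        where
        expand : ∀ a b p q → a * b * (p + q) ≡ q * b * a + p * a * b
        expand = solve-∀
      ∑dw≡L*M₁ : ∑ (edges G) (λ (u , v) → d u * d v * (w u + w v)) ≡ L * M₁ G
      ∑dw≡L*M₁ = begin-equality
        ∑ (edges G) (λ (u , v) → d u * d v * (w u + w v)) ≡⟨ ∑-cong (edges G) (λ (u , v) → L*d+d u v) ⟩
        ∑ (edges G) (λ (u , v) → L * (d u + d v))         ≡⟨ *-distribˡ-∑ (edges G) L _ ⟨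
        L * ∑ (edges G) (λ (u , v) → d u + d v)           ≡⟨ cong (L *_) (handshake d) ⟩
        L * ∑ (allFin n) (λ u → d u * d u)
          -- The square `degree G u ^ 2` in `M₁` unfolds to `d u * (d u * 1)`.
          ≡⟨ cong (L *_) (∑-cong (allFin n) λ u → cong (d u *_) (sym (*-identityʳ (d u)))) ⟩
        L * M₁ G                                          ∎
      rotate : ∀ x y z → x * y * z ≡ y * (z * x)
      rotate = solve-∀
      ∑∑< : M₂ G * ∑ (edges G) (λ (u , v) → w u + w v) <
            size G * ∑ (edges G) (λ (u , v) → d u * d v * (w u + w v))
      ∑∑< = begin-strict
        M₂ G * ∑ (edges G) (λ (u , v) → w u + w v) ≡⟨ cong (M₂ G *_) ∑w≡n*L ⟩
        M₂ G * (n * L)                             ≡⟨ *-assoc (M₂ G) n L ⟨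
        M₂ G * n * L                               <⟨ *-monoˡ-< L M₂n<M₁m ⟩
        M₁ G * size G * L                          ≡⟨ rotate (M₁ G) (size G) L ⟩
        size G * (L * M₁ G)                        ≡⟨ cong (size G *_) ∑dw≡L*M₁ ⟨
        size G * ∑ (edges G) (λ (u , v) → d u * d v * (w u + w v)) ∎

    InvertedEdges : Set
    InvertedEdges = ∃[ u ] ∃[ v ] ∃[ x ] ∃[ y ] (u , v) ∈ edges G × (x , y) ∈ edges G ×
                      Inverted (d u) (d v) (d x) (d y)

    similarlyOrderedEdges⇒invertedEdges : ∀ L (w : Fin n → ℕ) → (∀ u → L ≡ w u * d u) →
      (∃[ e ] ∃[ e′ ] e ∈ edges G × e′ ∈ edges G ×
        SimilarlyOrdered (λ (u , v) → d u * d v) (λ (u , v) → w u + w v) e e′) →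
      InvertedEdges
    similarlyOrderedEdges⇒invertedEdges L w L≡w*d ((u , v) , (x , y) , uv∈E , xy∈E , similar) =
      u , v , x , y , uv∈E , xy∈E , similarlyOrdered⇒inverted L w L≡w*d u v x y similar

    invertedEdges : M₂ G * n < M₁ G * size G → InvertedEdges
    invertedEdges M₂n<M₁m = similarlyOrderedEdges⇒invertedEdges L w L≡w*d
      (similarlyOrderedEdges L {{L≢0}} w L≡w*d M₂n<M₁m)
      where
      -- The product of all degrees serves as the common multiple; it is nonzero because no vertex
      -- is isolated.
      L = product (map d (allFin n))
      L≢0 : NonZero L
      L≢0 = product≢0 (map⁺ {xs = allFin n} (tabulate λ {u} _ → >-nonZero (degree>0 u)))
      d∣L : ∀ u → d u ∣ L
      d∣L u = ∈⇒∣product (∈-map⁺ d (∈-allFin u))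
      w : Fin n → ℕ
      w u = _∣_.quotient (d∣L u)
      L≡w*d : ∀ u → L ≡ w u * d u
      L≡w*d u = _∣_.equality (d∣L u)

    -- Degree spread at most 3, and the conclusion.

    module _ (Δ∸δ≤3 : Δ G ∸ δ G ≤ 3) where

      Δ≤δ+3 : Δ G ≤ δ G + 3
      Δ≤δ+3 = ≤-trans (m≤n+m∸n (Δ G) (δ G)) (+-monoʳ-≤ (δ G) Δ∸δ≤3)

      degree≤degree+3 : ∀ u v → d u ≤ d v + 3
      degree≤degree+3 u v =
        ≤-trans (degree≤Δ u) (≤-trans Δ≤δ+3 (+-monoˡ-≤ 3 (δ≤degree v)))

      -- Degrees 2 and 5 already differ by 3, the largest spread allowed, so they must be the
      -- extremes.
      degrees2,5⇒δ≡2×Δ≡5 : ∀ u v → d u ≡ 2 → d v ≡ 5 → δ G ≡ 2 × Δ G ≡ 5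
      degrees2,5⇒δ≡2×Δ≡5 u v du≡2 dv≡5 =
        ≤-antisym δ≤2 (+-cancelʳ-≤ 3 2 (δ G) (≤-trans 5≤Δ Δ≤δ+3)) ,
        ≤-antisym (≤-trans Δ≤δ+3 (+-monoˡ-≤ 3 δ≤2)) 5≤Δ
        where
        δ≤2 = subst (δ G ≤_) du≡2 (δ≤degree u)
        5≤Δ = subst (_≤ Δ G) dv≡5 (degree≤Δ v)

      orderedInvertedEdges : ∀ u v x y → Inverted (d u) (d v) (d x) (d y) → d u ≤ d v →
        d u ≡ 2 × d v ≡ 5 × d x ≡ 3 × d y ≡ 3
      orderedInvertedEdges u v x y inv du≤dv =
        inverted⇒2,5,3,3 (degree>0 u) du≤dv (degree≤degree+3 v u) inv

corollary2p2 : ∀ {n : ℕ} .{{_ : NonZero n}} (G : Graph n) (noIso : NoIsolatedVertices G) →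
    Δ G ∸ δ G ≤ 3 →
    (+ M₁ G) / order G > _/_ (+ M₂ G) (size G) {{size-nonZero G noIso}} →
    δ G ≡ 2 × Δ G ≡ 5 × edgesWithDegrees G 2 5 ≢ 0 × edgesWithDegrees G 3 3 ≢ 0
corollary2p2 {n} G noIso Δ∸δ≤3 M₁/n>M₂/m =
  conclusion (invertedEdges G noIso
    (/-<⇒*-< (M₂ G) (M₁ G) (size G) n {{size-nonZero G noIso}} M₁/n>M₂/m))
  where
  conclusion : InvertedEdges G noIso →
    δ G ≡ 2 × Δ G ≡ 5 × edgesWithDegrees G 2 5 ≢ 0 × edgesWithDegrees G 3 3 ≢ 0
  -- Edges are oriented by vertex index and not by degree, so either end of the first edge may be
  -- the one of degree 2.
  conclusion (u , v , x , y , uv∈E , xy∈E , inv) with ≤-total (degree G u) (degree G v)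
  ... | inj₁ du≤dv =
    let du≡2 , dv≡5 , dx≡3 , dy≡3 = orderedInvertedEdges G noIso Δ∸δ≤3 u v x y inv du≤dv
        δ≡2 , Δ≡5 = degrees2,5⇒δ≡2×Δ≡5 G noIso Δ∸δ≤3 u v du≡2 dv≡5
    in δ≡2 , Δ≡5 , edgesWithDegrees≢0 G uv∈E (inj₁ (du≡2 , dv≡5)) ,
       edgesWithDegrees≢0 G xy∈E (inj₁ (dx≡3 , dy≡3))
  ... | inj₂ dv≤du =
    let dv≡2 , du≡5 , dx≡3 , dy≡3 =
          orderedInvertedEdges G noIso Δ∸δ≤3 v u x y (inverted-comm inv) dv≤du
        δ≡2 , Δ≡5 = degrees2,5⇒δ≡2×Δ≡5 G noIso Δ∸δ≤3 v u dv≡2 du≡5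
    in δ≡2 , Δ≡5 , edgesWithDegrees≢0 G uv∈E (inj₂ (du≡5 , dv≡2)) ,
       edgesWithDegrees≢0 G xy∈E (inj₁ (dx≡3 , dy≡3))
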